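{- Let $w\in S_n$ be $k$-Grassmannian with $x_w\ne e$ (i.e. $x_w\neq\Lambda^k$ as an affine permutation). Then the right descent set of $x_w$ is exactly $\{s_0\}$. In particular $x_w$ lies in $(\tilde S_n^{(k)})^J$, i.e. $x_w$ is the unique element of minimal length in the coset $x_wW_J$.
   Context: Let $n\ge2$, $0\le k\le n$. $\tilde S_n$ is the group of bijections $f:\mathbb{Z}\to\mathbb{Z}$ with $f(i+n)=f(i)+n$, with products read left to right, $(fg)(a)=g(f(a))$. $\tilde S_n^{(k)}$ is the subset with $\frac1n\sum_{i=1}^n(f(i)-i)=k$. Length: $\ell(f)=\#\{(a,b):1\le a\le n,\ b\in\mathbb{Z},\ a<b,\ f(a)>f(b)\}$. $s_i$ ($0\le i\le n-1$) exchanges $i+mn$ and $i+1+mn$ for all $m$ and fixes all other integers. $\Lambda(i)=i+1$. Elements of $\tilde S_n^{(k)}$ are identified with elements of the affine Weyl group $\tilde S_n^{(0)}$ by $f\mapsto\Lambda^{ -k}f$; under this identification "$x_w=e$" means $\Lambda^{ -k}x_w=e$. The right descent set of $x$ is $\{s_i:\ell(xs_i)<\ell(x)\}$. $J=\{s_1,\dots,s_{n-1}\}$, $W_J=\langle J\rangle\cong S_n$, and $(\tilde S_n^{(k)})^J=\{x\in\tilde S_n^{(k)}:\ell(xs)>\ell(x)\ \forall s\in J\}$. A permutation $w\in S_n$ is $k$-Grassmannian if $w(1)<\dots<w(k)$ and $w(k+1)<\dots<w(n)$. $\tau_{k,n}\in\tilde S_n^{(k)}$ is given by $\tau_{k,n}(i)=i+n$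 for $1\le i\le k$ and $\tau_{k,n}(i)=i$ for $k+1\le i\le n$; and $x_w:=w^{ -1}\tau_{k,n}$, where $S_n\subset\tilde S_n$ via periodic extension. -}

module Defs where

open import Algebra.Bundles using (Group; AbelianGroup)
import Algebra.Properties.CommutativeMonoid.Sum as Sum
import Algebra.Properties.Group as GroupProperties
open import Data.Bool.Base using (if_then_else_)
open import Data.Fin.Base as Fin using (Fin; toℕ; fromℕ<)
import Data.Fin.Properties as Fin
open import Data.Fin.Permutation using (Permutation′; _⟨$⟩ʳ_; _⟨$⟩ˡ_; inverseʳ; inverseˡ)
open import Data.Integer.Base hiding (suc; _^_; NonZero)
open import Data.Integer.Properties
open import Data.Integer.DivMod using (n%ℕd<d; a≡a%ℕn+[a/ℕn]*n)
open import Data.Integer.Divisibility.Signed using (_∣_; divides; _∣?_; ∣⇒∣ᵤ)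
open import Data.Integer.Tactic.RingSolver using (solve-∀)
open import Data.List.Base as List using (List; []; _∷_; length; filter; upTo; cartesianProductWith)
open import Data.List.Membership.Propositional using () renaming (_∈_ to _∈ˡ_)
open import Data.List.Membership.Propositional.Properties
  using (∈-filter⁺; ∈-filter⁻; ∈-lookup; ∈-upTo⁺; ∈-cartesianProductWith⁺)
open import Data.List.Relation.Unary.All as All using (All)
import Data.List.Relation.Unary.AllPairs as AllPairs
open import Data.List.Relation.Unary.Any as Any using ()
open import Data.List.Relation.Unary.Any.Properties using (lookup-index)
open import Data.List.Relation.Unary.Unique.Propositional using (Unique)
import Data.List.Relation.Unary.Unique.Propositional.Properties as Unique
open import Data.Nat.Base as ℕ using (ℕ; suc; zero; NonZero; NonTrivial)
import Data.Nat.Divisibility as ℕ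
import Data.Nat.DivMod as ℕ
import Data.Nat.Properties as ℕ
open import Data.Product.Base using (_×_; _,_; proj₁; proj₂; ∃; ∃-syntax)
open import Data.Rational.Unnormalised.Base as ℚᵘ using (_≃_)
open import Function.Base using (_∘_; _on_)
open import Function.Bundles using (_↔_; Inverse; mk↔ₛ′)
open import Function.Construct.Composition using (_↔-∘_)
open import Function.Construct.Identity using (↔-id)
open import Function.Construct.Symmetry using (↔-sym)
open import Level using (0ℓ)
open import Relation.Binary.Core using (Rel)
open import Relation.Binary.Definitions using (tri<; tri≈; tri>)
open import Relation.Binary.PropositionalEquality hiding (J)
open import Relation.Nullary using (Dec; yes; no; ¬_; does; contradiction; Irrelevant)
open import Relation.Nullary.Decidable using (_×-dec_; dec-true; dec-false)
open import Relation.Unary using (Pred; Decidable; _∈_)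

record AffinePermutation (n : ℕ) : Set where
  field
    bijection : ℤ ↔ ℤ
  open Inverse bijection public using (to; from)
  field
    periodic : ∀ i → to (i + + n) ≡ to i + + n

open AffinePermutation public using (to; from; periodic)

module _ {n : ℕ} where

  infix  4 _≈_
  infixl 7 _·_
  infixl 8 _^_
  infix  8 _⁻¹

  to-from : (f : AffinePermutation n) → ∀ i → to f (from f i) ≡ i
  to-from f = Inverse.strictlyInverseˡ (AffinePermutation.bijection f)

  from-to : (f : AffinePermutation n) → ∀ i → from f (to f i) ≡ i
  from-to f = Inverse.strictlyInverseʳ (AffinePermutation.bijection f)

  _≈_ : Rel (AffinePermutation n) 0ℓ
  f ≈ g = ∀ i → to f i ≡ to g i

  -- Products are read left to right: to (f · g) i is to g (to f i).
  _·_ : AffinePermutation n → AffinePermutation n → AffinePermutation n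
  f · g = record
    { bijection = bijection g ↔-∘ bijection f
    ; periodic  = λ i → trans (cong (to g) (periodic f i)) (periodic g (to f i))
    } where open AffinePermutation using (bijection)

  ε : AffinePermutation n
  ε = record { bijection = ↔-id ℤ ; periodic = λ _ → refl }

  _⁻¹ : AffinePermutation n → AffinePermutation n
  f ⁻¹ = record
    { bijection = ↔-sym (AffinePermutation.bijection f)
    ; periodic  = λ i → begin
        from f (i + + n)                   ≡⟨ cong (λ j → from f (j + + n)) (to-from f i) ⟨
        from f (to f (from f i) + + n)     ≡⟨ cong (from f) (periodic f (from f i)) ⟨
        from f (to f (from f i + + n))     ≡⟨ from-to f _ ⟩
        from f i + + n                     ∎
    } where open ≡-Reasoning

  _^_ : AffinePermutation n → ℕ → AffinePermutation n
  f ^ zero  = ε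
  f ^ suc m = f · f ^ m

affineSymmetricGroup : ℕ → Group 0ℓ 0ℓ
affineSymmetricGroup n = record
  { Carrier = AffinePermutation n
  ; _≈_ = _≈_
  ; _∙_ = _·_
  ; ε = ε
  ; _⁻¹ = _⁻¹
  ; isGroup = record
    { isMonoid = record
      { isSemigroup = record
        { isMagma = record
          { isEquivalence = record
            { refl  = λ _ → refl
            ; sym   = λ p i → sym (p i)
            ; trans = λ p q i → trans (p i) (q i)
            }
          ; ∙-cong = λ {f} {g} {h} {k} p q i → trans (cong (to h) (p i)) (q (to g i))
          }
        ; assoc = λ _ _ _ _ → refl
        }
      ; identity = (λ _ _ → refl) , (λ _ _ → refl)
      }
    ; inverse = to-from , from-to
    ; ⁻¹-cong = λ {f} {g} p i → begin
        from f i                  ≡⟨ cong (from f) (to-from g i) ⟨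
        from f (to g (from g i))  ≡⟨ cong (from f) (p (from g i)) ⟨
        from f (to f (from g i))  ≡⟨ from-to f (from g i) ⟩
        from g i                  ∎
    }
  } where open ≡-Reasoning

module _ {n : ℕ} where

  IsInversion : AffinePermutation n → Pred (ℤ × ℤ) 0ℓ
  IsInversion f (a , b) = (1ℤ ≤ a × a ≤ + n) × a < b × to f a > to f b

  Inversion : AffinePermutation n → Set
  Inversion f = ∃ (IsInversion f)

private

  module ℤ-group = GroupProperties (AbelianGroup.group +-0-abelianGroup)

  lookup-injective : ∀ {A : Set} {xs : List A} → Unique xs →
                     ∀ {i j} → List.lookup xs i ≡ List.lookup xs j → i ≡ j
  lookup-injective (_ AllPairs.∷ _) {Fin.zero} {Fin.zero} _ = refl
  lookup-injective (x≢ AllPairs.∷ _) {Fin.zero} {Fin.suc j} eq =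
    contradiction eq (All.lookup x≢ (∈-lookup j))
  lookup-injective (x≢ AllPairs.∷ _) {Fin.suc i} {Fin.zero} eq =
    contradiction (sym eq) (All.lookup x≢ (∈-lookup i))
  lookup-injective (_ AllPairs.∷ u) {Fin.suc i} {Fin.suc j} eq =
    cong Fin.suc (lookup-injective u eq)

  count : ∀ {A : Set} {P : Pred A 0ℓ} (P? : Decidable P) →
          (∀ {x} → Irrelevant (P x)) → (xs : List A) → Unique xs →
          (∀ {x} → P x → x ∈ˡ xs) → ∃ P ↔ Fin (length (filter P? xs))
  count {A} {P} P? irr xs uniq complete = mk↔ₛ′ f g f-g g-f
    where
    ys = filter P? xs
    member : ∀ {x} → P x → x ∈ˡ ys
    member p = ∈-filter⁺ P? (complete p) p
    f : ∃ P → Fin (length ys)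
    f (x , p) = Any.index (member p)
    g : Fin (length ys) → ∃ P
    g i = List.lookup ys i , proj₂ (∈-filter⁻ P? {xs = xs} (∈-lookup i))
    f-g : ∀ i → f (g i) ≡ i
    f-g i = lookup-injective (Unique.filter⁺ P? uniq)
              (sym (lookup-index (member (proj₂ (g i)))))
    pair : ∀ {x y} (p : P x) (q : P y) → x ≡ y → (x , p) ≡ (y , q)
    pair p q refl = cong (_ ,_) (irr p q)
    g-f : ∀ x → g (f x) ≡ x
    g-f (x , p) = pair _ p (sym (lookup-index (member p)))

  inversion? : ∀ {n} (f : AffinePermutation n) → Decidable (IsInversion f)
  inversion? {n} f (a , b) =
    ((1ℤ ≤? a) ×-dec (a ≤? + n)) ×-dec (a <? b) ×-dec (to f b <? to f a)

  inversion-irrelevant : ∀ {n} (f : AffinePermutation n) {x} → Irrelevant (IsInversion f x)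
  inversion-irrelevant f ((p , q) , r , s) ((p′ , q′) , r′ , s′) =
    cong₂ _,_ (cong₂ _,_ (≤-irrelevant p p′) (≤-irrelevant q q′))
              (cong₂ _,_ (<-irrelevant r r′) (<-irrelevant s s′))

  module Bound {n : ℕ} .{{_ : NonZero n}} (f : AffinePermutation n) where

    maxAbs : ℕ → ℕ
    maxAbs zero    = ∣ to f 0ℤ ∣
    maxAbs (suc m) = ∣ to f (+ suc m) ∣ ℕ.+ maxAbs m

    maxAbs-bound : ∀ {i m} → i ℕ.≤ m → ∣ to f (+ i) ∣ ℕ.≤ maxAbs m
    maxAbs-bound {m = zero}  ℕ.z≤n = ℕ.≤-refl
    maxAbs-bound {i} {suc m} i≤1+m with i ℕ.≟ suc m
    ... | yes refl = ℕ.m≤m+n _ _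
    ... | no i≢    = ℕ.≤-trans (maxAbs-bound (ℕ.≤-pred (ℕ.≤∧≢⇒< i≤1+m i≢))) (ℕ.m≤n+m _ _)

    periodicℕ : ∀ i t → to f (i + + (t ℕ.* n)) ≡ to f i + + (t ℕ.* n)
    periodicℕ i zero    = trans (cong (to f) (+-identityʳ i)) (sym (+-identityʳ _))
    periodicℕ i (suc t) = begin
      to f (i + + (n ℕ.+ t ℕ.* n))  ≡⟨ cong (to f) (rearrange i) ⟩
      to f (i + + (t ℕ.* n) + + n)  ≡⟨ periodic f _ ⟩
      to f (i + + (t ℕ.* n)) + + n  ≡⟨ cong (_+ + n) (periodicℕ i t) ⟩
      to f i + + (t ℕ.* n) + + n    ≡⟨ rearrange (to f i) ⟨
      to f i + + (n ℕ.+ t ℕ.* n)    ∎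
      where
      open ≡-Reasoning
      rearrange : ∀ j → j + + (n ℕ.+ t ℕ.* n) ≡ j + + (t ℕ.* n) + + n
      rearrange j = trans (cong (λ m → j + + m) (ℕ.+-comm n (t ℕ.* n))) (sym (+-assoc j _ _))

    M : ℕ
    M = maxAbs n

    -∣i∣≤i : ∀ i → - (+ ∣ i ∣) ≤ i
    -∣i∣≤i (+ zero)  = ≤-refl
    -∣i∣≤i +[1+ _ ]  = -≤+
    -∣i∣≤i -[1+ _ ]  = ≤-refl

    i≤∣i∣ : ∀ i → i ≤ + ∣ i ∣
    i≤∣i∣ (+ _)    = ≤-refl
    i≤∣i∣ -[1+ _ ] = -≤+

    bound : ∀ {i j} → i ℕ.≤ n → to f (+ i) > to f (+ j) → j ℕ.< (suc (M ℕ.+ M)) ℕ.* n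
    bound {i} {j} i≤n fi>fj = ℕ.≰⇒> λ large → <⇒≱ fi>fj (begin
      to f (+ i)                         ≤⟨ i≤∣i∣ _ ⟩
      + ∣ to f (+ i) ∣                   ≤⟨ +≤+ (maxAbs-bound i≤n) ⟩
      + M                                ≡⟨ double (+ M) ⟩
      - (+ M) + (+ M + + M)              ≤⟨ +-mono-≤ (neg-mono-≤ (+≤+ (maxAbs-bound (ℕ.<⇒≤ (ℕ.m%n<n j n)))))
                                                     (+≤+ (2M≤ large)) ⟩
      - (+ ∣ to f (+ r) ∣) + + (t ℕ.* n) ≤⟨ +-monoˡ-≤ (+ (t ℕ.* n)) (-∣i∣≤i (to f (+ r))) ⟩
      to f (+ r) + + (t ℕ.* n)           ≡⟨ periodicℕ (+ r) t ⟨
      to f (+ (r ℕ.+ t ℕ.* n))           ≡⟨ cong (λ m → to f (+ m)) (ℕ.m≡m%n+[m/n]*n j n) ⟨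
      to f (+ j)                         ∎)
      where
      open ≤-Reasoning
      r = j ℕ.% n
      t = j ℕ./ n
      double : ∀ m → m ≡ - m + (m + m)
      double = solve-∀
      2M≤ : suc (M ℕ.+ M) ℕ.* n ℕ.≤ j → M ℕ.+ M ℕ.≤ t ℕ.* n
      2M≤ large = ℕ.≤-trans (ℕ.n≤1+n _) (ℕ.≤-trans
        (subst (ℕ._≤ t) (ℕ.m*n/n≡m (suc (M ℕ.+ M)) n) (ℕ./-monoˡ-≤ n large))
        (ℕ.m≤m*n t n))

    candidates : List (ℤ × ℤ)
    candidates = cartesianProductWith (λ a b → + a , + b) (upTo (suc n)) (upTo (suc (M ℕ.+ M) ℕ.* n))

    unique : Unique candidates
    unique = Unique.cartesianProductWith⁺ (λ a b → + a , + b) (λ { refl → refl , refl })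
               (Unique.upTo⁺ (suc n)) (Unique.upTo⁺ (suc (M ℕ.+ M) ℕ.* n))

    complete : ∀ {x} → IsInversion f x → x ∈ˡ candidates
    complete {+ i , + j} ((_ , +≤+ i≤n) , _ , fi>fj) =
      ∈-cartesianProductWith⁺ _ (∈-upTo⁺ (ℕ.s≤s i≤n)) (∈-upTo⁺ (bound i≤n fi>fj))
    complete { -[1+ _ ] , _} ((() , _) , _)
    complete {+ _ , -[1+ _ ]} (_ , () , _)

inversions-finite : ∀ {n} .{{_ : NonZero n}} (f : AffinePermutation n) →
                    ∃[ m ] (Inversion f ↔ Fin m)
inversions-finite f =
  _ , count (inversion? f) (inversion-irrelevant f) candidates unique complete
  where open Bound f

ℓ : ∀ {n} .{{_ : NonZero n}} → AffinePermutation n → ℕ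
ℓ f = proj₁ (inversions-finite f)

-- An index r : Fin n stands for the integer toℕ r + 1 in {1, …, n}; hence
-- toℕ r < k below means that this integer is at most k.
window : ∀ {n} → Fin n → ℤ
window r = + suc (toℕ r)

module _ {n : ℕ} .{{_ : NonZero n}} where

  residue : ℤ → Fin n
  residue a = fromℕ< (n%ℕd<d (a - 1ℤ) n)

  quotient : ℤ → ℤ
  quotient a = (a - 1ℤ) /ℕ n

  -- The function f with f (i + n) = f i + n and prescribed values on 1, …, n
  -- (see decompose and extend-translate).
  extend : (Fin n → ℤ) → ℤ → ℤ
  extend v a = v (residue a) + quotient a * + n

  decompose : ∀ a → a ≡ window (residue a) + quotient a * + n
  decompose a = begin
    a                                            ≡⟨ +-1 a ⟩
    1ℤ + (a - 1ℤ)                                ≡⟨ cong (λ m → 1ℤ + m) (a≡a%ℕn+[a/ℕn]*n (a - 1ℤ) n) ⟩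
    1ℤ + (+ ((a - 1ℤ) %ℕ n) + quotient a * + n)  ≡⟨ +-assoc 1ℤ (+ ((a - 1ℤ) %ℕ n)) (quotient a * + n) ⟨
    + suc ((a - 1ℤ) %ℕ n) + quotient a * + n     ≡⟨ cong (λ m → + suc m + quotient a * + n) (Fin.toℕ-fromℕ< (n%ℕd<d (a - 1ℤ) n)) ⟨
    window (residue a) + quotient a * + n        ∎
    where
    open ≡-Reasoning
    +-1 : ∀ a → a ≡ 1ℤ + (a - 1ℤ)
    +-1 = solve-∀

  private
    smaller : ∀ (r r′ : Fin n) {q q′} → q < q′ → window r + q * + n < window r′ + q′ * + n
    smaller r r′ {q} {q′} q<q′ = begin-strict
      window r + q * + n    ≤⟨ +-monoˡ-≤ (q * + n) (+≤+ (Fin.toℕ<n r)) ⟩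
      + n + q * + n         ≡⟨ suc-* q (+ n) ⟨
      (1ℤ + q) * + n        ≤⟨ *-monoʳ-≤-nonNeg (+ n) (i<j⇒suc[i]≤j q<q′) ⟩
      q′ * + n              ≡⟨ +-identityˡ _ ⟨
      0ℤ + q′ * + n         <⟨ +-monoˡ-< (q′ * + n) (+<+ ℕ.z<s) ⟩
      window r′ + q′ * + n  ∎
      where open ≤-Reasoning

  decompose-unique : ∀ {r r′ : Fin n} {q q′} → window r + q * + n ≡ window r′ + q′ * + n → r ≡ r′ × q ≡ q′
  decompose-unique {r} {r′} {q} {q′} eq with <-cmp q q′
  ... | tri< q<q′ _ _ = contradiction eq (<⇒≢ (smaller r r′ q<q′))
  ... | tri> _ _ q′<q = contradiction (sym eq) (<⇒≢ (smaller r′ r q′<q))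
  ... | tri≈ _ refl _ =
    Fin.toℕ-injective (ℕ.suc-injective (+-injective (ℤ-group.∙-cancelʳ (q * + n) (window r) (window r′) eq))) , refl

  extend-translate : ∀ v r q → extend v (window r + q * + n) ≡ v r + q * + n
  extend-translate v r q = cong₂ (λ r q → v r + q * + n) (proj₁ same) (proj₂ same)
    where
    a = window r + q * + n
    same : residue a ≡ r × quotient a ≡ q
    same = decompose-unique {residue a} {r} {quotient a} {q} (sym (decompose a))

  extend-window : ∀ v r → extend v (window r) ≡ v r
  extend-window v r = begin
    extend v (window r)             ≡⟨ cong (extend v) (+-identityʳ (window r)) ⟨
    extend v (window r + 0ℤ * + n)  ≡⟨ extend-translate v r 0ℤ ⟩
    v r + 0ℤ                        ≡⟨ +-identityʳ (v r) ⟩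
    v r                             ∎
    where open ≡-Reasoning

  extend-periodic : ∀ v a q → extend v (a + q * + n) ≡ extend v a + q * + n
  extend-periodic v a q = begin
    extend v (a + q * + n)                                      ≡⟨ cong (λ b → extend v (b + q * + n)) (decompose a) ⟩
    extend v (window (residue a) + quotient a * + n + q * + n)  ≡⟨ cong (extend v) (collect (window (residue a)) (quotient a) q (+ n)) ⟩
    extend v (window (residue a) + (quotient a + q) * + n)      ≡⟨ extend-translate v (residue a) (quotient a + q) ⟩
    v (residue a) + (quotient a + q) * + n                      ≡⟨ collect (v (residue a)) (quotient a) q (+ n) ⟨
    extend v a + q * + n                                        ∎
    where
    open ≡-Reasoning
    collect : ∀ x y z m → x + y * m + z * m ≡ x + (y + z) * m
    collect = solve-∀

  extend-inverse : ∀ u v → (∀ r → extend v (u r) ≡ window r) → ∀ a → extend v (extend u a) ≡ a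
  extend-inverse u v inv a = begin
    extend v (u (residue a) + quotient a * + n)  ≡⟨ extend-periodic v (u (residue a)) (quotient a) ⟩
    extend v (u (residue a)) + quotient a * + n  ≡⟨ cong (_+ quotient a * + n) (inv (residue a)) ⟩
    window (residue a) + quotient a * + n        ≡⟨ decompose a ⟨
    a                                            ∎
    where open ≡-Reasoning

  extendBijection : (v u : Fin n → ℤ) → (∀ r → extend v (u r) ≡ window r) →
                    (∀ r → extend u (v r) ≡ window r) → AffinePermutation n
  extendBijection v u vu uv = record
    { bijection = mk↔ₛ′ (extend v) (extend u) (extend-inverse u v vu) (extend-inverse v u uv)
    ; periodic  = λ i → subst (λ m → extend v (i + m) ≡ extend v i + m) (*-identityˡ (+ n))
                              (extend-periodic v i 1ℤ)
    }

  fromPermutation : Permutation′ n → AffinePermutation n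
  fromPermutation w = extendBijection (window ∘ (w ⟨$⟩ʳ_)) (window ∘ (w ⟨$⟩ˡ_))
    (λ r → trans (extend-window (window ∘ (w ⟨$⟩ʳ_)) (w ⟨$⟩ˡ r)) (cong window (inverseʳ w)))
    (λ r → trans (extend-window (window ∘ (w ⟨$⟩ˡ_)) (w ⟨$⟩ʳ r)) (cong window (inverseˡ w)))

  τWindow τ⁻¹Window : ℕ → Fin n → ℤ
  τWindow   k r = if does (toℕ r ℕ.<? k) then window r + + n else window r
  τ⁻¹Window k r = if does (toℕ r ℕ.<? k) then window r - + n else window r

  τWindow-< : ∀ {k r} → toℕ r ℕ.< k → τWindow k r ≡ window r + + n
  τWindow-< {k} {r} r<k =
    cong (λ b → if b then window r + + n else window r) (dec-true (toℕ r ℕ.<? k) r<k)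

  τWindow-≥ : ∀ {k r} → ¬ (toℕ r ℕ.< k) → τWindow k r ≡ window r
  τWindow-≥ {k} {r} r≮k =
    cong (λ b → if b then window r + + n else window r) (dec-false (toℕ r ℕ.<? k) r≮k)

  private
    τ⁻¹Window-< : ∀ {k r} → toℕ r ℕ.< k → τ⁻¹Window k r ≡ window r - + n
    τ⁻¹Window-< {k} {r} r<k =
      cong (λ b → if b then window r - + n else window r) (dec-true (toℕ r ℕ.<? k) r<k)

    τ⁻¹Window-≥ : ∀ {k r} → ¬ (toℕ r ℕ.< k) → τ⁻¹Window k r ≡ window r
    τ⁻¹Window-≥ {k} {r} r≮k =
      cong (λ b → if b then window r - + n else window r) (dec-false (toℕ r ℕ.<? k) r≮k)

    plus : ∀ x m → x + m ≡ x + 1ℤ * m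
    plus = solve-∀

    minus : ∀ x m → x - m ≡ x + (- 1ℤ) * m
    minus = solve-∀

    τ-inverseˡ : ∀ k r → extend (τWindow k) (τ⁻¹Window k r) ≡ window r
    τ-inverseˡ k r = by-cases (toℕ r ℕ.<? k)
      where
      open ≡-Reasoning
      cancel : ∀ x m → x + m + (- 1ℤ) * m ≡ x
      cancel = solve-∀
      by-cases : Dec (toℕ r ℕ.< k) → extend (τWindow k) (τ⁻¹Window k r) ≡ window r
      by-cases (yes r<k) = begin
        extend (τWindow k) (τ⁻¹Window k r)            ≡⟨ cong (extend (τWindow k)) (trans (τ⁻¹Window-< r<k) (minus (window r) (+ n))) ⟩
        extend (τWindow k) (window r + (- 1ℤ) * + n)  ≡⟨ extend-translate (τWindow k) r (- 1ℤ) ⟩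
        τWindow k r + (- 1ℤ) * + n                    ≡⟨ cong (_+ (- 1ℤ) * + n) (τWindow-< r<k) ⟩
        window r + + n + (- 1ℤ) * + n                 ≡⟨ cancel (window r) (+ n) ⟩
        window r                                      ∎
      by-cases (no r≮k) = begin
        extend (τWindow k) (τ⁻¹Window k r)  ≡⟨ cong (extend (τWindow k)) (τ⁻¹Window-≥ r≮k) ⟩
        extend (τWindow k) (window r)       ≡⟨ extend-window (τWindow k) r ⟩
        τWindow k r                         ≡⟨ τWindow-≥ r≮k ⟩
        window r                            ∎

    τ-inverseʳ : ∀ k r → extend (τ⁻¹Window k) (τWindow k r) ≡ window r
    τ-inverseʳ k r = by-cases (toℕ r ℕ.<? k)
      where
      open ≡-Reasoning
      cancel : ∀ x m → x - m + 1ℤ * m ≡ x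
      cancel = solve-∀
      by-cases : Dec (toℕ r ℕ.< k) → extend (τ⁻¹Window k) (τWindow k r) ≡ window r
      by-cases (yes r<k) = begin
        extend (τ⁻¹Window k) (τWindow k r)          ≡⟨ cong (extend (τ⁻¹Window k)) (trans (τWindow-< r<k) (plus (window r) (+ n))) ⟩
        extend (τ⁻¹Window k) (window r + 1ℤ * + n)  ≡⟨ extend-translate (τ⁻¹Window k) r 1ℤ ⟩
        τ⁻¹Window k r + 1ℤ * + n                    ≡⟨ cong (_+ 1ℤ * + n) (τ⁻¹Window-< r<k) ⟩
        window r - + n + 1ℤ * + n                   ≡⟨ cancel (window r) (+ n) ⟩
        window r                                    ∎
      by-cases (no r≮k) = begin
        extend (τ⁻¹Window k) (τWindow k r)  ≡⟨ cong (extend (τ⁻¹Window k)) (τWindow-≥ r≮k) ⟩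
        extend (τ⁻¹Window k) (window r)     ≡⟨ extend-window (τ⁻¹Window k) r ⟩
        τ⁻¹Window k r                       ≡⟨ τ⁻¹Window-≥ r≮k ⟩
        window r                            ∎

  τ : ℕ → AffinePermutation n
  τ k = extendBijection (τWindow k) (τ⁻¹Window k) (τ-inverseˡ k) (τ-inverseʳ k)

Λ : ∀ {n} → AffinePermutation n
Λ {n} = record
  { bijection = mk↔ₛ′ (_+ 1ℤ) (_- 1ℤ) (λ i → cancel₁ i) (λ i → cancel₂ i)
  ; periodic  = λ i → swap i (+ n)
  }
  where
  cancel₁ : ∀ i → i - 1ℤ + 1ℤ ≡ i
  cancel₁ = solve-∀
  cancel₂ : ∀ i → i + 1ℤ - 1ℤ ≡ i
  cancel₂ = solve-∀
  swap : ∀ i m → i + m + 1ℤ ≡ i + 1ℤ + m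
  swap = solve-∀

-- The element f of S̃ₙ⁽ᵏ⁾ viewed in the affine Weyl group S̃ₙ⁽⁰⁾.
toAffineWeyl : ∀ {n} → ℕ → AffinePermutation n → AffinePermutation n
toAffineWeyl k f = (Λ ⁻¹) ^ k · f

module _ {n : ℕ} .{{_ : NonTrivial n}} where

  swapFunction : ℤ → ℤ → ℤ
  swapFunction i a =
    if does (+ n ∣? a - i) then a + 1ℤ else
    if does (+ n ∣? a - (i + 1ℤ)) then a - 1ℤ else a

  private
    n∤1 : ¬ (+ n ∣ 1ℤ)
    n∤1 n∣1 = ℕ.nonTrivial⇒≢1 (ℕ.∣1⇒≡1 (∣⇒∣ᵤ n∣1))

    -- i and i + 1 are distinct modulo n
    disjoint : ∀ i a → + n ∣ a - i → ¬ (+ n ∣ a - (i + 1ℤ))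
    disjoint i a (divides q p) (divides q′ p′) = n∤1 (divides (q - q′) (begin
      1ℤ                          ≡⟨ split a i ⟩
      (a - i) - (a - (i + 1ℤ))    ≡⟨ cong₂ _-_ p p′ ⟩
      q * + n - q′ * + n          ≡⟨ factor q q′ (+ n) ⟩
      (q - q′) * + n              ∎))
      where
      open ≡-Reasoning
      split : ∀ a i → 1ℤ ≡ (a - i) - (a - (i + 1ℤ))
      split = solve-∀
      factor : ∀ q q′ m → q * m - q′ * m ≡ (q - q′) * m
      factor = solve-∀

  swapFunction-up : ∀ i a → + n ∣ a - i → swapFunction i a ≡ a + 1ℤ
  swapFunction-up i a p =
    cong (λ b → if b then a + 1ℤ else if does (+ n ∣? a - (i + 1ℤ)) then a - 1ℤ else a)
         (dec-true (+ n ∣? a - i) p)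

  swapFunction-down : ∀ i a → + n ∣ a - (i + 1ℤ) → swapFunction i a ≡ a - 1ℤ
  swapFunction-down i a q =
    cong₂ (λ b c → if b then a + 1ℤ else if c then a - 1ℤ else a)
          (dec-false (+ n ∣? a - i) (λ p → disjoint i a p q))
          (dec-true (+ n ∣? a - (i + 1ℤ)) q)

  swapFunction-fix : ∀ i a → ¬ (+ n ∣ a - i) → ¬ (+ n ∣ a - (i + 1ℤ)) → swapFunction i a ≡ a
  swapFunction-fix i a ¬p ¬q =
    cong₂ (λ b c → if b then a + 1ℤ else if c then a - 1ℤ else a)
          (dec-false (+ n ∣? a - i) ¬p) (dec-false (+ n ∣? a - (i + 1ℤ)) ¬q)

  swapFunction-involutive : ∀ i a → swapFunction i (swapFunction i a) ≡ a
  swapFunction-involutive i a = by-cases (+ n ∣? a - i) (+ n ∣? a - (i + 1ℤ))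
    where
    shift₁ : ∀ a i → a - i ≡ a + 1ℤ - (i + 1ℤ)
    shift₁ = solve-∀
    shift₂ : ∀ a i → a - (i + 1ℤ) ≡ a - 1ℤ - i
    shift₂ = solve-∀
    cancel₁ : ∀ a → a + 1ℤ - 1ℤ ≡ a
    cancel₁ = solve-∀
    cancel₂ : ∀ a → a - 1ℤ + 1ℤ ≡ a
    cancel₂ = solve-∀
    by-cases : Dec (+ n ∣ a - i) → Dec (+ n ∣ a - (i + 1ℤ)) → swapFunction i (swapFunction i a) ≡ a
    by-cases (yes p) _ =
      trans (cong (swapFunction i) (swapFunction-up i a p))
     (trans (swapFunction-down i (a + 1ℤ) (subst (+ n ∣_) (shift₁ a i) p)) (cancel₁ a))
    by-cases (no _) (yes q) =
      trans (cong (swapFunction i) (swapFunction-down i a q))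
     (trans (swapFunction-up i (a - 1ℤ) (subst (+ n ∣_) (shift₂ a i) q)) (cancel₂ a))
    by-cases (no ¬p) (no ¬q) =
      trans (cong (swapFunction i) (swapFunction-fix i a ¬p ¬q)) (swapFunction-fix i a ¬p ¬q)

  private
    ∣-shift : ∀ a j → + n ∣ a - j → + n ∣ a + + n - j
    ∣-shift a j (divides q p) = divides (q + 1ℤ) (trans (out a (+ n) j) (trans (cong (_+ + n) p) (factor q (+ n))))
      where
      out : ∀ a m j → a + m - j ≡ a - j + m
      out = solve-∀
      factor : ∀ q m → q * m + m ≡ (q + 1ℤ) * m
      factor = solve-∀

    ∣-unshift : ∀ a j → + n ∣ a + + n - j → + n ∣ a - j
    ∣-unshift a j (divides q p) = divides (q - 1ℤ) (trans (out a (+ n) j) (trans (cong (_- + n) p) (factor q (+ n))))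
      where
      out : ∀ a m j → a - j ≡ a + m - j - m
      out = solve-∀
      factor : ∀ q m → q * m - m ≡ (q - 1ℤ) * m
      factor = solve-∀

  swapFunction-periodic : ∀ i a → swapFunction i (a + + n) ≡ swapFunction i a + + n
  swapFunction-periodic i a = by-cases (+ n ∣? a - i) (+ n ∣? a - (i + 1ℤ))
    where
    up : ∀ a m → a + m + 1ℤ ≡ a + 1ℤ + m
    up = solve-∀
    down : ∀ a m → a + m - 1ℤ ≡ a - 1ℤ + m
    down = solve-∀
    by-cases : Dec (+ n ∣ a - i) → Dec (+ n ∣ a - (i + 1ℤ)) → swapFunction i (a + + n) ≡ swapFunction i a + + n
    by-cases (yes p) _ =
      trans (swapFunction-up i (a + + n) (∣-shift a i p))
     (trans (up a (+ n)) (cong (_+ + n) (sym (swapFunction-up i a p))))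
    by-cases (no _) (yes q) =
      trans (swapFunction-down i (a + + n) (∣-shift a (i + 1ℤ) q))
     (trans (down a (+ n)) (cong (_+ + n) (sym (swapFunction-down i a q))))
    by-cases (no ¬p) (no ¬q) =
      trans (swapFunction-fix i (a + + n) (¬p ∘ ∣-unshift a i) (¬q ∘ ∣-unshift a (i + 1ℤ)))
            (cong (_+ + n) (sym (swapFunction-fix i a ¬p ¬q)))

  -- Defined for every i : ℕ, but the generators are those with i < n.
  s : ℕ → AffinePermutation n
  s i = record
    { bijection = mk↔ₛ′ (swapFunction (+ i)) (swapFunction (+ i))
                        (swapFunction-involutive (+ i)) (swapFunction-involutive (+ i))
    ; periodic  = swapFunction-periodic (+ i)
    }

Grassmannian : ∀ {n} → ℕ → Permutation′ n → Set
Grassmannian k w =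
  (∀ {i j} → i Fin.< j → toℕ j ℕ.< k → w ⟨$⟩ʳ i Fin.< w ⟨$⟩ʳ j) ×
  (∀ {i j} → k ℕ.≤ toℕ i → i Fin.< j → w ⟨$⟩ʳ i Fin.< w ⟨$⟩ʳ j)

-- The generated subgroup; closure under ≈ is needed because group elements are
-- compared by _≈_ rather than _≡_.
data ⟨_⟩ {n : ℕ} (P : Pred (AffinePermutation n) 0ℓ) : Pred (AffinePermutation n) 0ℓ where
  generator : ∀ {f} → f ∈ P → f ∈ ⟨ P ⟩
  identity  : ε ∈ ⟨ P ⟩
  product   : ∀ {f g} → f ∈ ⟨ P ⟩ → g ∈ ⟨ P ⟩ → f · g ∈ ⟨ P ⟩
  inverse   : ∀ {f} → f ∈ ⟨ P ⟩ → f ⁻¹ ∈ ⟨ P ⟩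
  respects  : ∀ {f g} → f ≈ g → f ∈ ⟨ P ⟩ → g ∈ ⟨ P ⟩

LeftCoset : ∀ {n} → AffinePermutation n → Pred (AffinePermutation n) 0ℓ → Pred (AffinePermutation n) 0ℓ
LeftCoset x H y = ∃[ u ] u ∈ H × y ≈ x · u

module _ {n : ℕ} .{{_ : NonTrivial n}} where

  private
    instance
      n≢0 : NonZero n
      n≢0 = ℕ.nonTrivial⇒nonZero n

  open Sum +-0-commutativeMonoid using (sum)

  x[_,_] : ℕ → Permutation′ n → AffinePermutation n
  x[ k , w ] = fromPermutation w ⁻¹ · τ k

  S̃⁽_⁾ : ℕ → Pred (AffinePermutation n) 0ℓ
  S̃⁽ k ⁾ f = sum {n} (λ r → to f (window r) - window r) ℚᵘ./ n ≃ + k ℚᵘ./ 1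

  RightDescentSet : AffinePermutation n → Pred (AffinePermutation n) 0ℓ
  RightDescentSet x g = ∃[ i ] i ℕ.< n × g ≈ s i × ℓ (x · s i) ℕ.< ℓ x

  J : Pred (AffinePermutation n) 0ℓ
  J g = ∃[ i ] 1 ℕ.≤ i × i ℕ.< n × g ≈ s i

  W_J : Pred (AffinePermutation n) 0ℓ
  W_J = ⟨ J ⟩

  S̃ᴶ⁽_⁾ : ℕ → Pred (AffinePermutation n) 0ℓ
  S̃ᴶ⁽ k ⁾ x = x ∈ S̃⁽ k ⁾ × (∀ {g} → g ∈ J → ℓ (x · g) ℕ.> ℓ x)

  IsShortest : Pred (AffinePermutation n) 0ℓ → Pred (AffinePermutation n) 0ℓ
  IsShortest C y = y ∈ C × (∀ {z} → z ∈ C → ℓ y ℕ.≤ ℓ z)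

  IsUniqueShortest : Pred (AffinePermutation n) 0ℓ → Pred (AffinePermutation n) 0ℓ
  IsUniqueShortest C x = IsShortest C x × (∀ {y} → IsShortest C y → y ≈ x)

{-# OPTIONS --safe #-}

-- The element x = x_w has x⁻¹ = [w(1) − n, …, w(k) − n, w(k+1), …, w(n)] in window
-- notation, and w(k) − n ≤ 0 < w(k+1), so x⁻¹ is increasing on {1, …, n}. Whenever
-- x⁻¹(i) < x⁻¹(i+1), all inversions of x are inversions of x sᵢ, and the pair
-- (x⁻¹(i), x⁻¹(i+1)) is a new one. If also x⁻¹(0) < x⁻¹(1), then x⁻¹ is increasing on ℤ,
-- hence a translation, and the sum of the displacements identifies x as Λᵏ. For the
-- coset, an element u of W_J permutes each block {1, …, n} + qn, and an inversion of x
-- has its values in different blocks, so it remains an inversion of x u; if there are no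
-- others, then u is increasing on every block and hence trivial.
module Submission where

open import Defs
open import Data.Fin.Permutation using (Permutation′)
open import Data.Nat.Base using (ℕ; NonTrivial; _≤_)
open import Data.Product.Base using (_×_)
open import Relation.Nullary using (¬_)
open import Relation.Unary using (_∈_; _≐_)

import Algebra.Properties.CommutativeMonoid.Sum as Sum
open import Data.Bool.Base using (true; false; if_then_else_)
open import Data.Fin.Base as Fin using (Fin; toℕ; fromℕ<)
open import Data.Fin.Permutation using (_⟨$⟩ʳ_)
import Data.Fin.Properties as Fin
open import Data.Integer.Base as ℤ
  using (ℤ; +_; -[1+_]; 0ℤ; 1ℤ; _+_; _-_; _*_; -_; _<_; _>_)
open import Data.Integer.Divisibility.Signed using (_∣_; divides; _∣?_)
import Data.Integer.Properties as ℤ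
open import Data.Integer.Tactic.RingSolver using (solve-∀)
open import Data.Nat.Base as ℕ using (zero; suc; NonZero)
import Data.Nat.Properties as ℕ
open import Data.Product.Base using (_,_; proj₁; proj₂; ∃; ∃-syntax)
open import Data.Rational.Unnormalised.Base using (*≡*; ↥_; ↧_; _/_)
import Data.Rational.Unnormalised.Properties as ℚᵘ
open import Data.Sum.Base using (_⊎_; inj₁; inj₂)
open import Function.Base using (_∘_; _on_)
open import Function.Bundles using (Inverse; Injection)
open import Function.Definitions using (Injective)
open import Function.Properties.Inverse using (↔⇒↣; ↔-sym)
open import Relation.Binary.Definitions using (tri<; tri≈; tri>)
open import Relation.Binary.PropositionalEquality hiding (J)
open import Relation.Nullary using (Dec; yes; no; does; contradiction; Irrelevant)

open Sum ℤ.+-0-commutativeMonoid using (sum; sum-permute; sum-cong-≗; ∑-distrib-+; sum-replicate-zero)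

+-cancelʳ-< : ∀ k {i j} → i + k < j + k → i < j
+-cancelʳ-< k {i} {j} i+k<j+k = subst₂ _<_ (cancel i k) (cancel j k) (ℤ.+-monoˡ-< (- k) i+k<j+k)
  where
  cancel : ∀ i k → i + k + - k ≡ i
  cancel = solve-∀

i<j⇒i+1≤j : ∀ {i j} → i < j → i + 1ℤ ℤ.≤ j
i<j⇒i+1≤j {i} {j} i<j = subst (ℤ._≤ j) (ℤ.+-comm 1ℤ i) (ℤ.i<j⇒suc[i]≤j i<j)

i<j⇒i≤j-1 : ∀ {i j} → i < j → i ℤ.≤ j - 1ℤ
i<j⇒i≤j-1 {i} {j} i<j = subst (i ℤ.≤_) (ℤ.+-comm (- 1ℤ) j) (ℤ.i<j⇒i≤pred[j] i<j)

i<i+1 : ∀ i → i < i + 1ℤ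
i<i+1 i = ℤ.suc[i]≤j⇒i<j (ℤ.≤-reflexive (ℤ.+-comm 1ℤ i))

i<j⇒j≡i+suc : ∀ {i j} → i < j → ∃[ m ] j ≡ i + + suc m
i<j⇒j≡i+suc {i} {j} i<j = from-nonNeg (j - (1ℤ + i)) (ℤ.i≤j⇒0≤j-i (ℤ.i<j⇒suc[i]≤j i<j)) (split i j)
  where
  split : ∀ i j → j ≡ i + (1ℤ + (j - (1ℤ + i)))
  split = solve-∀
  from-nonNeg : ∀ d → 0ℤ ℤ.≤ d → j ≡ i + (1ℤ + d) → ∃[ m ] j ≡ i + + suc m
  from-nonNeg (+ m) _ eq = m , eq

i-j≡k⇒i≡j+k : ∀ {i j k} → i - j ≡ k → i ≡ j + k
i-j≡k⇒i≡j+k {i} {j} refl = rearrange i j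
  where
  rearrange : ∀ i j → i ≡ j + (i - j)
  rearrange = solve-∀

i≡j+k⇒i+1≡j+1+k : ∀ {i} j k → i ≡ j + k → i + 1ℤ ≡ j + 1ℤ + k
i≡j+k⇒i+1≡j+1+k j k refl = rearrange j k
  where
  rearrange : ∀ j k → j + k + 1ℤ ≡ j + 1ℤ + k
  rearrange = solve-∀

i≡j+1+k⇒i-1≡j+k : ∀ {i} j k → i ≡ j + 1ℤ + k → i - 1ℤ ≡ j + k
i≡j+1+k⇒i-1≡j+k j k refl = rearrange j k
  where
  rearrange : ∀ j k → j + 1ℤ + k - 1ℤ ≡ j + k
  rearrange = solve-∀

injective∧missing⇒< : ∀ {m n} {f : Fin m → Fin n} → Injective _≡_ _≡_ f →
                      ∀ p → (∀ i → p ≢ f i) → m ℕ.< n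
injective∧missing⇒< {m} {n} {f} inj p p≢ = Fin.injective⇒≤ {f = g} g-injective
  where
  g : Fin (suc m) → Fin n
  g Fin.zero    = p
  g (Fin.suc i) = f i
  g-injective : Injective _≡_ _≡_ g
  g-injective {Fin.zero}  {Fin.zero}  _  = refl
  g-injective {Fin.zero}  {Fin.suc j} eq = contradiction eq (p≢ j)
  g-injective {Fin.suc i} {Fin.zero}  eq = contradiction (sym eq) (p≢ i)
  g-injective {Fin.suc i} {Fin.suc j} eq = cong Fin.suc (inj eq)

sum-const : ∀ m c → sum {m} (λ _ → c) ≡ + m * c
sum-const zero    c = refl
sum-const (suc m) c = trans (cong (_+_ c) (sum-const m c)) (sym (ℤ.suc-* (+ m) c))

sum-first : ∀ {m k c} → k ≤ m → sum {m} (λ r → if does (toℕ r ℕ.<? k) then c else 0ℤ) ≡ + k * c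
sum-first {m}     {zero}      _         = sum-replicate-zero m
sum-first {suc m} {suc k} {c} (ℕ.s≤s k≤m) =
  trans (cong (_+_ c) (sum-first k≤m)) (sym (ℤ.suc-* (+ k) c))

module _ {n : ℕ} where

  from-unique : (f : AffinePermutation n) → ∀ {i j} → to f i ≡ j → from f j ≡ i
  from-unique f {i} refl = from-to f i

  to-periodic : (f : AffinePermutation n) → ∀ i q → to f (i + q * + n) ≡ to f i + q * + n
  to-periodic f = λ
    { i (+ t)    → nonNeg i t
    ; i -[1+ t ] → begin
        to f (i + - + suc t * + n)                                    ≡⟨ cancel₁ _ (+ suc t) (+ n) ⟩
        to f (i + - + suc t * + n) + + suc t * + n + - + suc t * + n  ≡⟨ cong (_+ - + suc t * + n) (nonNeg _ (suc t)) ⟨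
        to f (i + - + suc t * + n + + suc t * + n) + - + suc t * + n  ≡⟨ cong (λ j → to f j + - + suc t * + n) (cancel₂ i (+ suc t) (+ n)) ⟩
        to f i + - + suc t * + n                                      ∎
    }
    where
    open ≡-Reasoning
    peel : ∀ i t m → i + (1ℤ + t) * m ≡ i + t * m + m
    peel = solve-∀
    cancel₁ : ∀ i p m → i ≡ i + p * m + - p * m
    cancel₁ = solve-∀
    cancel₂ : ∀ i p m → i + - p * m + p * m ≡ i
    cancel₂ = solve-∀
    nonNeg : ∀ i t → to f (i + + t * + n) ≡ to f i + + t * + n
    nonNeg i zero    = trans (cong (to f) (ℤ.+-identityʳ i)) (sym (ℤ.+-identityʳ _))
    nonNeg i (suc t) = begin
      to f (i + + suc t * + n)    ≡⟨ cong (to f) (peel i (+ t) (+ n)) ⟩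
      to f (i + + t * + n + + n)  ≡⟨ periodic f _ ⟩
      to f (i + + t * + n) + + n  ≡⟨ cong (_+ + n) (nonNeg i t) ⟩
      to f i + + t * + n + + n    ≡⟨ peel (to f i) (+ t) (+ n) ⟨
      to f i + + suc t * + n      ∎

  to-reflects-shifted-< : (f : AffinePermutation n) → ∀ i j q →
                          to f (i + q * + n) < to f (j + q * + n) → to f i < to f j
  to-reflects-shifted-< f i j q = +-cancelʳ-< (q * + n) ∘ subst₂ _<_ (to-periodic f i q) (to-periodic f j q)

  to-shifted-< : (f : AffinePermutation n) → ∀ {i j} q →
                 to f i < to f j → to f (i + q * + n) < to f (j + q * + n)
  to-shifted-< f {i} {j} q = subst₂ _<_ (sym (to-periodic f i q)) (sym (to-periodic f j q)) ∘ ℤ.+-monoˡ-< (q * + n)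

  IsInversion-irrelevant : (f : AffinePermutation n) → ∀ {x} → Irrelevant (IsInversion f x)
  IsInversion-irrelevant f ((p , q) , r , s) ((p′ , q′) , r′ , s′) =
    cong₂ _,_ (cong₂ _,_ (ℤ.≤-irrelevant p p′) (ℤ.≤-irrelevant q q′))
              (cong₂ _,_ (ℤ.<-irrelevant r r′) (ℤ.<-irrelevant s s′))

  Inversion-≡ : (f : AffinePermutation n) → ∀ {x y : Inversion f} → proj₁ x ≡ proj₁ y → x ≡ y
  Inversion-≡ f {_ , p} {_ , q} refl = cong (_ ,_) (IsInversion-irrelevant f p q)

  Λ⁻¹^-to : ∀ k i → to ((Λ {n} ⁻¹) ^ k) i ≡ i - + k
  Λ⁻¹^-to zero    i = sym (ℤ.+-identityʳ i)
  Λ⁻¹^-to (suc k) i = trans (Λ⁻¹^-to k (i - 1ℤ)) (rearrange i (+ k))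
    where
    rearrange : ∀ i k → i - 1ℤ - k ≡ i - (1ℤ + k)
    rearrange = solve-∀

module _ {n : ℕ} .{{_ : NonZero n}} where

  InversionsPersist : AffinePermutation n → AffinePermutation n → Set
  InversionsPersist f g = ∀ a b → a < b → to f a > to f b → to g a > to g b

  private
    module Embedding (f g : AffinePermutation n) (persist : InversionsPersist f g) where

      module F = Inverse (proj₂ (inversions-finite f))
      module G = Inverse (proj₂ (inversions-finite g))

      embed : Inversion f → Inversion g
      embed ((a , b) , range , a<b , fa>fb) = (a , b) , range , a<b , persist a b a<b fa>fb

      φ : Fin (ℓ f) → Fin (ℓ g)
      φ = G.to ∘ embed ∘ F.from

      φ-injective : Injective _≡_ _≡_ φ
      φ-injective = Injection.injective (↔⇒↣ (↔-sym (proj₂ (inversions-finite f))))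
                  ∘ Inversion-≡ f ∘ cong proj₁
                  ∘ Injection.injective (↔⇒↣ (proj₂ (inversions-finite g)))

  ℓ-mono-≤ : ∀ f g → InversionsPersist f g → ℓ f ℕ.≤ ℓ g
  ℓ-mono-≤ f g persist = Fin.injective⇒≤ (Embedding.φ-injective f g persist)

  ℓ-cong-≤ : ∀ f g → f ≈ g → ℓ f ℕ.≤ ℓ g
  ℓ-cong-≤ f g f≈g = ℓ-mono-≤ f g λ a b _ → subst₂ _<_ (f≈g b) (f≈g a)

  ℓ-mono-< : ∀ f g → InversionsPersist f g →
             ∀ {a b} → a < b → ¬ (to f a > to f b) → to g a > to g b → ℓ f ℕ.< ℓ g
  ℓ-mono-< f g persist {a} {b} a<b fa≯fb ga>gb =
    injective∧missing⇒< φ-injective (G.to new) λ i eq →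
      not-old (F.from i) (cong proj₁ (Injection.injective (↔⇒↣ (proj₂ (inversions-finite g))) eq))
    where
    open Embedding f g persist
    q = quotient a
    a₀ b₀ : ℤ
    a₀ = window (residue a)
    b₀ = b - q * + n
    b-shift : b ≡ b₀ + q * + n
    b-shift = cancel b (q * + n)
      where
      cancel : ∀ b m → b ≡ b - m + m
      cancel = solve-∀
    new : Inversion g
    new = (a₀ , b₀)
        , (ℤ.+≤+ (ℕ.s≤s ℕ.z≤n) , ℤ.+≤+ (Fin.toℕ<n (residue a)))
        , +-cancelʳ-< (q * + n) (subst₂ _<_ (decompose a) b-shift a<b)
        , to-reflects-shifted-< g b₀ a₀ q
            (subst₂ (_<_ on to g) b-shift (decompose a) ga>gb)
    not-old : (y : Inversion f) → (a₀ , b₀) ≢ proj₁ y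
    not-old (_ , _ , _ , fa₀>fb₀) refl =
      fa≯fb (subst₂ (_<_ on to f) (sym b-shift) (sym (decompose a)) (to-shifted-< f q fa₀>fb₀))

  quotient-suc : ∀ {i} → i ℕ.< n → ∀ q → quotient (+ suc i + q * + n) ≡ q
  quotient-suc {i} i<n q = proj₂ (decompose-unique {r = residue a} {r′ = r} {q = quotient a} {q′ = q} (begin
    window (residue a) + quotient a * + n  ≡⟨ decompose a ⟨
    a                                      ≡⟨ cong (λ m → + suc m + q * + n) (Fin.toℕ-fromℕ< i<n) ⟨
    window r + q * + n                     ∎))
    where
    open ≡-Reasoning
    a = + suc i + q * + n
    r = fromℕ< i<n

  quotient-reflects-< : ∀ {a b} → quotient a < quotient b → a < b
  quotient-reflects-< {a} {b} qa<qb = begin-strict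
    a                                      ≡⟨ decompose a ⟩
    window (residue a) + quotient a * + n  ≤⟨ ℤ.+-monoˡ-≤ (quotient a * + n) (ℤ.+≤+ (Fin.toℕ<n (residue a))) ⟩
    + n + quotient a * + n                 ≡⟨ ℤ.suc-* (quotient a) (+ n) ⟨
    (1ℤ + quotient a) * + n                ≤⟨ ℤ.*-monoʳ-≤-nonNeg (+ n) (ℤ.i<j⇒suc[i]≤j qa<qb) ⟩
    quotient b * + n                       ≡⟨ ℤ.+-identityˡ _ ⟨
    0ℤ + quotient b * + n                  <⟨ ℤ.+-monoˡ-< (quotient b * + n) (ℤ.+<+ ℕ.z<s) ⟩
    window (residue b) + quotient b * + n  ≡⟨ decompose b ⟨
    b                                      ∎
    where open ℤ.≤-Reasoning

  quotient-0<1 : quotient {n} 0ℤ < quotient {n} 1ℤ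
  quotient-0<1 = subst₂ _<_ (sym quotient-0) (sym quotient-1) ℤ.-<+
    where
    open ≡-Reasoning
    quotient-0 : quotient {n} 0ℤ ≡ - 1ℤ
    quotient-0 = begin
      quotient {n} 0ℤ                                ≡⟨ cong quotient (cancel (+ n)) ⟩
      quotient {n} (+ n + - 1ℤ * + n)                ≡⟨ cong (λ m → quotient (+ m + - 1ℤ * + n)) (ℕ.suc-pred n) ⟨
      quotient {n} (+ suc (ℕ.pred n) + - 1ℤ * + n)   ≡⟨ quotient-suc (ℕ.≤-reflexive (ℕ.suc-pred n)) (- 1ℤ) ⟩
      - 1ℤ                                           ∎
      where
      cancel : ∀ m → 0ℤ ≡ m + - 1ℤ * m
      cancel = solve-∀
    quotient-1 : quotient {n} 1ℤ ≡ 0ℤ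
    quotient-1 = quotient-suc (ℕ.>-nonZero⁻¹ n) 0ℤ

  -- The blocks are the intervals {1, …, n} + qn, on which quotient is constant.
  quotient-step : ∀ i → quotient i ≡ quotient (i + 1ℤ) ⊎ (∃[ q ] i ≡ q * + n)
  quotient-step i with suc (toℕ (residue {n} i)) ℕ.<? n
  ... | yes 1+r<n = inj₁ (sym (begin
      quotient (i + 1ℤ)                             ≡⟨ cong (λ j → quotient (j + 1ℤ)) (decompose i) ⟩
      quotient (window (residue i) + q * + n + 1ℤ)  ≡⟨ cong quotient (swap (window (residue i)) (q * + n)) ⟩
      quotient (1ℤ + window (residue i) + q * + n)  ≡⟨ quotient-suc 1+r<n q ⟩
      q                                             ∎))
    where
    open ≡-Reasoning
    q = quotient i
    swap : ∀ w m → w + m + 1ℤ ≡ 1ℤ + w + m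
    swap = solve-∀
  ... | no 1+r≮n = inj₂ (1ℤ + q , (begin
      i                               ≡⟨ decompose i ⟩
      window (residue i) + q * + n    ≡⟨ cong (λ m → + m + q * + n) (ℕ.≤-antisym (Fin.toℕ<n (residue i)) (ℕ.≮⇒≥ 1+r≮n)) ⟩
      + n + q * + n                   ≡⟨ ℤ.suc-* q (+ n) ⟨
      (1ℤ + q) * + n                  ∎))
    where
    open ≡-Reasoning
    q = quotient i

module _ {n : ℕ} where

  Increasing : AffinePermutation n → Set
  Increasing f = ∀ a b → a < b → to f a < to f b

  increasing-reflects-< : ∀ f → Increasing f → ∀ {a b} → to f a < to f b → a < b
  increasing-reflects-< f inc {a} {b} fa<fb with ℤ.<-cmp a b
  ... | tri< a<b _ _ = a<b
  ... | tri≈ _ a≡b _ = contradiction (cong (to f) a≡b) (ℤ.<⇒≢ fa<fb)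
  ... | tri> _ _ a>b = contradiction (inc b a a>b) (ℤ.<-asym fa<fb)

  steps⇒increasing : ∀ f → (∀ i → to f i < to f (i + 1ℤ)) → Increasing f
  steps⇒increasing f step a b a<b with i<j⇒j≡i+suc a<b
  ... | m , refl = go m
    where
    go : ∀ m → to f a < to f (a + + suc m)
    go zero    = step a
    go (suc m) = ℤ.<-trans (go m) (subst (λ j → to f (a + + suc m) < to f j) (reassoc a (+ suc m)) (step _))
      where
      reassoc : ∀ a m → a + m + 1ℤ ≡ a + (1ℤ + m)
      reassoc = solve-∀

  increasing⇒translation : ∀ f → Increasing f → ∃[ c ] ∀ i → to f i ≡ i + c
  increasing⇒translation f inc = to f 0ℤ , λ
    { (+ m)    → trans (cong (to f) (sym (ℤ.+-identityˡ (+ m)))) (trans (shift 0ℤ m) (ℤ.+-comm (to f 0ℤ) (+ m)))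
    ; -[1+ m ] → negative (+ suc m) (trans (cong (to f) (sym (ℤ.+-inverseˡ (+ suc m)))) (shift -[1+ m ] (suc m)))
    }
    where
    negative : ∀ p {x y} → y ≡ x + p → x ≡ - p + y
    negative p {x} refl = cancel p x
      where
      cancel : ∀ p x → x ≡ - p + (x + p)
      cancel = solve-∀
    step : ∀ i → to f (i + 1ℤ) ≡ to f i + 1ℤ
    step i with ℤ.<-cmp (to f (i + 1ℤ)) (to f i + 1ℤ)
    ... | tri< lt _ _ = contradiction (i<j⇒i+1≤j (inc i (i + 1ℤ) (i<i+1 i))) (ℤ.<⇒≱ lt)
    ... | tri≈ _ eq _ = eq
    ... | tri> _ _ gt = contradiction (i<j⇒i+1≤j i<j) (ℤ.<⇒≱ j<i+1)
      where
      j = from f (to f i + 1ℤ)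
      fj≡ : to f j ≡ to f i + 1ℤ
      fj≡ = to-from f _
      i<j : i < j
      i<j = increasing-reflects-< f inc (subst (to f i <_) (sym fj≡) (i<i+1 (to f i)))
      j<i+1 : j < i + 1ℤ
      j<i+1 = increasing-reflects-< f inc (subst (_< to f (i + 1ℤ)) (sym fj≡) gt)
    shift : ∀ i m → to f (i + + m) ≡ to f i + + m
    shift i zero    = trans (cong (to f) (ℤ.+-identityʳ i)) (sym (ℤ.+-identityʳ (to f i)))
    shift i (suc m) = begin
      to f (i + + suc m)    ≡⟨ cong (to f) (reassoc i (+ m)) ⟨
      to f (i + + m + 1ℤ)   ≡⟨ step _ ⟩
      to f (i + + m) + 1ℤ   ≡⟨ cong (_+ 1ℤ) (shift i m) ⟩
      to f i + + m + 1ℤ     ≡⟨ reassoc (to f i) (+ m) ⟩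
      to f i + + suc m      ∎
      where
      open ≡-Reasoning
      reassoc : ∀ i m → i + m + 1ℤ ≡ i + (1ℤ + m)
      reassoc = solve-∀

module _ {n : ℕ} .{{_ : NonZero n}} where

  BlockIncreasing : AffinePermutation n → Set
  BlockIncreasing f = ∀ a b → quotient a ≡ quotient b → a < b → to f a < to f b

  BlockPreserving : AffinePermutation n → Set
  BlockPreserving f = ∀ a → quotient (to f a) ≡ quotient a

  window-increasing⇒blockIncreasing : ∀ f →
    (∀ {r r′ : Fin n} → r Fin.< r′ → to f (window r) < to f (window r′)) → BlockIncreasing f
  window-increasing⇒blockIncreasing f inc a b qa≡qb a<b =
    subst₂ (_<_ on to f) (sym (decompose a)) (sym b≡) (to-shifted-< f (quotient a) (inc r<r′))
    where
    b≡ : b ≡ window (residue b) + quotient a * + n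
    b≡ = trans (decompose b) (cong (λ q → window (residue b) + q * + n) (sym qa≡qb))
    r<r′ : residue a Fin.< residue b
    r<r′ = ℕ.s<s⁻¹ (ℤ.drop‿+<+ (+-cancelʳ-< (quotient a * + n) (subst₂ _<_ (decompose a) b≡ a<b)))

  -- An inversion of f has its larger value in a strictly higher block.
  blockPreserving⇒persist : ∀ f u → BlockIncreasing (f ⁻¹) → BlockPreserving u → InversionsPersist f (f · u)
  blockPreserving⇒persist f u inc pres a b a<b fa>fb with ℤ.<-cmp (quotient (to f a)) (quotient (to f b))
  ... | tri< qa<qb _ _ = contradiction (quotient-reflects-< qa<qb) (ℤ.<-asym fa>fb)
  ... | tri≈ _ qa≡qb _ = contradiction (subst₂ _<_ (from-to f b) (from-to f a) (inc (to f b) (to f a) (sym qa≡qb) fa>fb)) (ℤ.<-asym a<b)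
  ... | tri> _ _ qa>qb = quotient-reflects-< (subst₂ _<_ (sym (pres (to f b))) (sym (pres (to f a))) qa>qb)

  blockPreserving∧increasing⇒identity : ∀ u → BlockPreserving u → Increasing u → u ≈ ε
  blockPreserving∧increasing⇒identity u pres inc i = trans (translation i) (trans (cong (_+_ i) c≡0) (ℤ.+-identityʳ i))
    where
    c = proj₁ (increasing⇒translation u inc)
    translation : ∀ i → to u i ≡ i + c
    translation = proj₂ (increasing⇒translation u inc)
    quotient-translate : ∀ i → quotient (i + c) ≡ quotient i
    quotient-translate i = trans (cong quotient (sym (translation i))) (pres i)
    0<1+c : 0ℤ < 1ℤ + c
    0<1+c = quotient-reflects-< (subst (quotient 0ℤ <_) (sym (quotient-translate 1ℤ)) quotient-0<1)
    c<1 : 0ℤ + c < 1ℤ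
    c<1 = quotient-reflects-< (subst (_< quotient 1ℤ) (sym (quotient-translate 0ℤ)) quotient-0<1)
    c≡0 : c ≡ 0ℤ
    c≡0 = ℤ.≤-antisym (i<j⇒i≤j-1 (subst (_< 1ℤ) (ℤ.+-identityˡ c) c<1))
                      (subst (0ℤ ℤ.≤_) (cancel c) (i<j⇒i≤j-1 0<1+c))
      where
      cancel : ∀ c → 1ℤ + c - 1ℤ ≡ c
      cancel = solve-∀

  blockPreserving∧ℓ≤⇒≈ : ∀ f u → BlockIncreasing (f ⁻¹) → BlockPreserving u →
                         ℓ (f · u) ℕ.≤ ℓ f → f · u ≈ f
  blockPreserving∧ℓ≤⇒≈ f u inc pres ℓ≤ = blockPreserving∧increasing⇒identity u pres u-increasing ∘ to f
    where
    u-increasing : Increasing u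
    u-increasing a b a<b with ℤ.<-cmp (quotient a) (quotient b)
    ... | tri< qa<qb _ _ = quotient-reflects-< (subst₂ _<_ (sym (pres a)) (sym (pres b)) qa<qb)
    ... | tri> _ _ qa>qb = contradiction (quotient-reflects-< qa>qb) (ℤ.<-asym a<b)
    ... | tri≈ _ qa≡qb _ with ℤ.<-cmp (to u a) (to u b)
    ...   | tri< ua<ub _ _ = ua<ub
    ...   | tri≈ _ ua≡ub _ = contradiction (trans (sym (from-to u a)) (from-unique u (sym ua≡ub))) (ℤ.<⇒≢ a<b)
    ...   | tri> _ _ ua>ub = contradiction ℓ≤ (ℕ.<⇒≱ (ℓ-mono-< f (f · u) (blockPreserving⇒persist f u inc pres)
              (inc a b qa≡qb a<b)
              (ℤ.<-asym (subst₂ _<_ (sym (to-from f a)) (sym (to-from f b)) a<b))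
              (subst₂ (_<_ on to u) (sym (to-from f b)) (sym (to-from f a)) ua>ub)))

module _ {n : ℕ} .{{_ : NonTrivial n}} where

  private
    instance
      n≢0 : NonZero n
      n≢0 = ℕ.nonTrivial⇒nonZero n

  module _ (i : ℤ) where

    private
      σ : ℤ → ℤ
      σ = swapFunction {n} i

    swapFunction-≤ : ∀ {a} → ¬ (+ n ∣ a - i) → σ a ℤ.≤ a
    swapFunction-≤ {a} n∤ with + n ∣? a - (i + 1ℤ)
    ... | yes p = ℤ.≤-trans (ℤ.≤-reflexive (swapFunction-down i a p)) (ℤ.i-j≤i a 1ℤ)
    ... | no ¬p = ℤ.≤-reflexive (swapFunction-fix i a n∤ ¬p)

    swapFunction-≥ : ∀ {a} → ¬ (+ n ∣ a - (i + 1ℤ)) → a ℤ.≤ σ a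
    swapFunction-≥ {a} n∤ with + n ∣? a - i
    ... | yes p = ℤ.≤-trans (ℤ.i≤i+j a 1ℤ) (ℤ.≤-reflexive (sym (swapFunction-up i a p)))
    ... | no ¬p = ℤ.≤-reflexive (sym (swapFunction-fix i a ¬p n∤))

    swapFunction-≥-1 : ∀ a → a - 1ℤ ℤ.≤ σ a
    swapFunction-≥-1 a with + n ∣? a - (i + 1ℤ)
    ... | yes p = ℤ.≤-reflexive (sym (swapFunction-down i a p))
    ... | no ¬p = ℤ.≤-trans (ℤ.i-j≤i a 1ℤ) (swapFunction-≥ ¬p)

    swapFunction-injective : ∀ {a b} → σ a ≡ σ b → a ≡ b
    swapFunction-injective {a} {b} eq =
      trans (sym (swapFunction-involutive i a)) (trans (cong σ eq) (swapFunction-involutive i b))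

    swapFunction-mono-< : ∀ {a b} → a < b → ¬ (b ≡ a + 1ℤ × + n ∣ a - i) → σ a < σ b
    swapFunction-mono-< {a} {b} a<b ¬swapped =
      ℤ.≤∧≢⇒< (σa≤σb (+ n ∣? a - i) (+ n ∣? b - (i + 1ℤ))) (ℤ.<⇒≢ a<b ∘ swapFunction-injective)
      where
      open ℤ.≤-Reasoning
      σa≤σb : Dec (+ n ∣ a - i) → Dec (+ n ∣ b - (i + 1ℤ)) → σ a ℤ.≤ σ b
      σa≤σb (yes p) _ = begin
        σ a      ≡⟨ swapFunction-up i a p ⟩
        a + 1ℤ   ≤⟨ i<j⇒i≤j-1 (ℤ.≤∧≢⇒< (i<j⇒i+1≤j a<b) (λ eq → ¬swapped (sym eq , p))) ⟩
        b - 1ℤ   ≤⟨ swapFunction-≥-1 b ⟩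
        σ b      ∎
      σa≤σb (no ¬p) (yes q) = begin
        σ a      ≤⟨ swapFunction-≤ ¬p ⟩
        a        ≤⟨ i<j⇒i≤j-1 a<b ⟩
        b - 1ℤ   ≡⟨ swapFunction-down i b q ⟨
        σ b      ∎
      σa≤σb (no ¬p) (no ¬q) = begin
        σ a      ≤⟨ swapFunction-≤ ¬p ⟩
        a        <⟨ a<b ⟩
        b        ≤⟨ swapFunction-≥ ¬q ⟩
        σ b      ∎

    swapFunction-left : σ i ≡ i + 1ℤ
    swapFunction-left = swapFunction-up i i (divides 0ℤ (ℤ.+-inverseʳ i))

    swapFunction-right : σ (i + 1ℤ) ≡ i
    swapFunction-right = trans (swapFunction-down i (i + 1ℤ) (divides 0ℤ (ℤ.+-inverseʳ (i + 1ℤ)))) (cancel i)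
      where
      cancel : ∀ i → i + 1ℤ - 1ℤ ≡ i
      cancel = solve-∀

  ℓ-ascent : ∀ (f : AffinePermutation n) i → from f (+ i) < from f (+ i + 1ℤ) → ℓ f ℕ.< ℓ (f · s i)
  ℓ-ascent f i asc = ℓ-mono-< f (f · s i) persist asc
    (ℤ.<-asym (subst₂ _<_ (sym left) (sym right) (i<i+1 (+ i))))
    (subst₂ _<_ (sym (trans (cong σ right) (swapFunction-right (+ i))))
                (sym (trans (cong σ left) (swapFunction-left (+ i)))) (i<i+1 (+ i)))
    where
    σ = swapFunction {n} (+ i)
    left : to f (from f (+ i)) ≡ + i
    left = to-from f (+ i)
    right : to f (from f (+ i + 1ℤ)) ≡ + i + 1ℤ
    right = to-from f (+ i + 1ℤ)
    persist : InversionsPersist f (f · s i)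
    persist a b a<b fa>fb = swapFunction-mono-< (+ i) fa>fb λ
      { (fa≡fb+1 , divides q fb-i≡qn) →
          let fb≡i+qn = i-j≡k⇒i≡j+k {to f b} {+ i} fb-i≡qn in
          ℤ.<-asym a<b (subst₂ _<_
            (from-unique f fb≡i+qn)
            (from-unique f (trans fa≡fb+1 (i≡j+k⇒i+1≡j+1+k (+ i) (q * + n) fb≡i+qn)))
            (to-shifted-< (f ⁻¹) q asc)) }

  ℓ-descent : ∀ (f : AffinePermutation n) i → from f (+ i + 1ℤ) < from f (+ i) → ℓ (f · s i) ℕ.< ℓ f
  ℓ-descent f i desc = ℕ.<-≤-trans
    (ℓ-ascent (f · s i) i (subst₂ (_<_ on from f) (sym (swapFunction-left (+ i))) (sym (swapFunction-right (+ i))) desc))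
    (ℓ-mono-≤ (f · s i · s i) f
      (λ a b _ → subst₂ _<_ (swapFunction-involutive (+ i) (to f b)) (swapFunction-involutive (+ i) (to f a))))

  s-blockPreserving : ∀ {i} → 1 ℕ.≤ i → i ℕ.< n → BlockPreserving (s {n} i)
  s-blockPreserving {suc i} _ 1+i<n a = by-cases (+ n ∣? a - + suc i) (+ n ∣? a - (+ suc i + 1ℤ))
    where
    σ = swapFunction {n} (+ suc i)
    q-lower : ∀ {b} q → b ≡ + suc i + q * + n → quotient {n} b ≡ q
    q-lower q refl = quotient-suc (ℕ.<⇒≤ 1+i<n) q
    q-upper : ∀ {b} q → b ≡ + suc i + 1ℤ + q * + n → quotient {n} b ≡ q
    q-upper q refl = trans (cong (λ j → quotient {n} (j + q * + n)) (ℤ.+-comm (+ suc i) 1ℤ)) (quotient-suc 1+i<n q)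
    by-cases : Dec (+ n ∣ a - + suc i) → Dec (+ n ∣ a - (+ suc i + 1ℤ)) → quotient {n} (σ a) ≡ quotient {n} a
    by-cases (yes p@(divides q eq)) _ =
      let a≡ = i-j≡k⇒i≡j+k {a} {+ suc i} eq in
      trans (q-upper q (trans (swapFunction-up (+ suc i) a p) (i≡j+k⇒i+1≡j+1+k (+ suc i) (q * + n) a≡)))
            (sym (q-lower q a≡))
    by-cases (no _) (yes p@(divides q eq)) =
      let a≡ = i-j≡k⇒i≡j+k {a} {+ suc i + 1ℤ} eq in
      trans (q-lower q (trans (swapFunction-down (+ suc i) a p) (i≡j+1+k⇒i-1≡j+k (+ suc i) (q * + n) a≡)))
            (sym (q-upper q a≡))
    by-cases (no ¬p) (no ¬q) = cong quotient (swapFunction-fix (+ suc i) a ¬p ¬q)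

  W_J-blockPreserving : ∀ {u : AffinePermutation n} → u ∈ W_J → BlockPreserving u
  W_J-blockPreserving (generator (i , 1≤i , i<n , f≈sᵢ)) a =
    trans (cong quotient (f≈sᵢ a)) (s-blockPreserving 1≤i i<n a)
  W_J-blockPreserving identity a = refl
  W_J-blockPreserving (product {f} f∈ g∈) a =
    trans (W_J-blockPreserving g∈ (to f a)) (W_J-blockPreserving f∈ a)
  W_J-blockPreserving (inverse {f} f∈) a =
    trans (sym (W_J-blockPreserving f∈ (from f a))) (cong quotient (to-from f a))
  W_J-blockPreserving (respects f≈g f∈) a =
    trans (cong quotient (sym (f≈g a))) (W_J-blockPreserving f∈ a)

  blockIncreasing⇒uniqueShortest : ∀ (f : AffinePermutation n) → BlockIncreasing (f ⁻¹) →
                                   IsUniqueShortest (LeftCoset f W_J) f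
  blockIncreasing⇒uniqueShortest f inc = (f∈fW_J , shortest) , unique
    where
    f∈fW_J : f ∈ LeftCoset f W_J
    f∈fW_J = ε , identity , λ _ → refl
    shortest : ∀ {z} → z ∈ LeftCoset f W_J → ℓ f ℕ.≤ ℓ z
    shortest {z} (u , u∈ , z≈fu) = ℕ.≤-trans
      (ℓ-mono-≤ f (f · u) (blockPreserving⇒persist f u inc (W_J-blockPreserving u∈)))
      (ℓ-cong-≤ (f · u) z (sym ∘ z≈fu))
    unique : ∀ {y} → IsShortest (LeftCoset f W_J) y → y ≈ f
    unique {y} ((u , u∈ , y≈fu) , minimal) i = trans (y≈fu i)
      (blockPreserving∧ℓ≤⇒≈ f u inc (W_J-blockPreserving u∈)
        (ℕ.≤-trans (ℓ-cong-≤ (f · u) y (sym ∘ y≈fu)) (minimal f∈fW_J)) i)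

  quotient-suc≡ : ∀ {i} → suc i ℕ.< n → quotient {n} (+ suc i) ≡ quotient {n} (+ suc i + 1ℤ)
  quotient-suc≡ {i} 1+i<n = begin
    quotient {n} (+ suc i)                   ≡⟨ cong (quotient {n}) (ℤ.+-identityʳ (+ suc i)) ⟨
    quotient {n} (+ suc i + 0ℤ * + n)        ≡⟨ quotient-suc (ℕ.<⇒≤ 1+i<n) 0ℤ ⟩
    0ℤ                                       ≡⟨ quotient-suc 1+i<n 0ℤ ⟨
    quotient {n} (+ suc (suc i) + 0ℤ * + n)  ≡⟨ cong (quotient {n}) (trans (ℤ.+-identityʳ (+ suc (suc i))) (ℤ.+-comm 1ℤ (+ suc i))) ⟩
    quotient {n} (+ suc i + 1ℤ)              ∎
    where open ≡-Reasoning

  blockIncreasing∧descent₀⇒minimal : ∀ (f : AffinePermutation n) → BlockIncreasing (f ⁻¹) →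
    from f 1ℤ < from f 0ℤ → ∀ k → f ∈ S̃⁽ k ⁾ →
    (RightDescentSet f ≐ (_≈ s 0)) × (f ∈ S̃ᴶ⁽ k ⁾) × IsUniqueShortest (LeftCoset f W_J) f
  blockIncreasing∧descent₀⇒minimal f inc desc k f∈S̃ =
    ((λ {g} → descent⇒s₀ {g}) , λ g≈s₀ → 0 , ℕ.>-nonZero⁻¹ n , g≈s₀ , ℓ-descent f 0 desc) ,
    (f∈S̃ , λ {g} → minimal {g}) ,
    blockIncreasing⇒uniqueShortest f inc
    where
    ascent : ∀ i → 1 ≤ i → i ℕ.< n → ℓ f ℕ.< ℓ (f · s i)
    ascent (suc i) _ 1+i<n =
      ℓ-ascent f (suc i) (inc (+ suc i) (+ suc i + 1ℤ) (quotient-suc≡ 1+i<n) (i<i+1 (+ suc i)))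
    descent⇒s₀ : ∀ {g} → g ∈ RightDescentSet f → g ≈ s 0
    descent⇒s₀ (zero  , _   , g≈s₀ , _)   = g≈s₀
    descent⇒s₀ (suc i , i<n , _    , ℓ<ℓ) = contradiction ℓ<ℓ (ℕ.<-asym (ascent (suc i) (ℕ.s≤s ℕ.z≤n) i<n))
    minimal : ∀ {g} → g ∈ J → ℓ (f · g) ℕ.> ℓ f
    minimal {g} (i , 1≤i , i<n , g≈sᵢ) = ℕ.<-≤-trans (ascent i 1≤i i<n)
      (ℓ-cong-≤ (f · s i) (f · g) (λ a → sym (g≈sᵢ (to f a))))

  module _ (k : ℕ) (w : Permutation′ n) where

    private
      x : AffinePermutation n
      x = x[ k , w ]

    x-window : ∀ (r : Fin n) → to x (window (w ⟨$⟩ʳ r)) ≡ τWindow k r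
    x-window r = begin
      to (τ k) (from (fromPermutation w) (window (w ⟨$⟩ʳ r)))  ≡⟨ cong (to (τ k)) (from-unique (fromPermutation w) {window r} (extend-window (window ∘ (w ⟨$⟩ʳ_)) r)) ⟩
      to (τ k) (window r)                                      ≡⟨ extend-window (τWindow k) r ⟩
      τWindow k r                                              ∎
      where open ≡-Reasoning

    x⁻¹-window-< : ∀ {r : Fin n} → toℕ r ℕ.< k → from x (window r) + + n ≡ window (w ⟨$⟩ʳ r)
    x⁻¹-window-< {r} r<k = trans (sym (periodic (x ⁻¹) (window r)))
                                 (from-unique x (trans (x-window r) (τWindow-< r<k)))

    x⁻¹-window-≥ : ∀ {r : Fin n} → ¬ (toℕ r ℕ.< k) → from x (window r) ≡ window (w ⟨$⟩ʳ r)
    x⁻¹-window-≥ {r} r≮k = from-unique x (trans (x-window r) (τWindow-≥ r≮k))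

    x⁻¹-blockIncreasing : Grassmannian k w → BlockIncreasing (x ⁻¹)
    x⁻¹-blockIncreasing (inc-< , inc-≥) = window-increasing⇒blockIncreasing (x ⁻¹) increasing
      where
      increasing : ∀ {r r′ : Fin n} → r Fin.< r′ → from x (window r) < from x (window r′)
      increasing {r} {r′} r<r′ with toℕ r ℕ.<? k | toℕ r′ ℕ.<? k
      ... | _       | yes r′<k = +-cancelʳ-< (+ n) (subst₂ _<_
              (sym (x⁻¹-window-< (ℕ.<-trans r<r′ r′<k))) (sym (x⁻¹-window-< r′<k))
              (ℤ.+<+ (ℕ.s<s (inc-< r<r′ r′<k))))
      ... | no r≮k  | no r′≮k  = subst₂ _<_ (sym (x⁻¹-window-≥ r≮k)) (sym (x⁻¹-window-≥ r′≮k))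
              (ℤ.+<+ (ℕ.s<s (inc-≥ (ℕ.≮⇒≥ r≮k) r<r′)))
      ... | yes r<k | no r′≮k  = +-cancelʳ-< (+ n) (begin-strict
              from x (window r) + + n   ≡⟨ x⁻¹-window-< r<k ⟩
              window (w ⟨$⟩ʳ r)         ≤⟨ ℤ.+≤+ (Fin.toℕ<n (w ⟨$⟩ʳ r)) ⟩
              0ℤ + + n                  <⟨ ℤ.+-monoˡ-< (+ n) (ℤ.+<+ ℕ.z<s) ⟩
              window (w ⟨$⟩ʳ r′) + + n  ≡⟨ cong (_+ + n) (x⁻¹-window-≥ r′≮k) ⟨
              from x (window r′) + + n  ∎)
        where open ℤ.≤-Reasoning

    x-sum : k ≤ n → sum {n} (λ r → to x (window r) - window r) ≡ + k * + n
    x-sum k≤n = begin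
      sum {n} (λ r → to x (window r) - window r)                              ≡⟨ sum-permute {n} {n} (λ r → to x (window r) - window r) w ⟩
      sum {n} (λ r → to x (window (w ⟨$⟩ʳ r)) - window (w ⟨$⟩ʳ r))            ≡⟨ sum-cong-≗ {n} (λ r → cong (_- window (w ⟨$⟩ʳ r)) (x-window r)) ⟩
      sum {n} (λ r → τWindow k r - window (w ⟨$⟩ʳ r))                         ≡⟨ ∑-distrib-+ {n} (τWindow k) (λ r → - window (w ⟨$⟩ʳ r)) ⟩
      sum {n} (τWindow k) + sum {n} (λ r → - window (w ⟨$⟩ʳ r))               ≡⟨ cong (_+_ (sum {n} (τWindow k))) (sum-permute {n} {n} (λ r → - window r) w) ⟨
      sum {n} (τWindow k) + sum {n} (λ r → - window r)                        ≡⟨ ∑-distrib-+ {n} (τWindow k) (λ r → - window r) ⟨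
      sum {n} (λ r → τWindow k r - window r)                                  ≡⟨ sum-cong-≗ {n} displacement ⟩
      sum {n} (λ r → if does (toℕ r ℕ.<? k) then + n else 0ℤ)                 ≡⟨ sum-first k≤n ⟩
      + k * + n                                                               ∎
      where
      open ≡-Reasoning
      cancel : ∀ a m → a + m - a ≡ m
      cancel = solve-∀
      displacement : ∀ (r : Fin n) → τWindow k r - window r ≡ (if does (toℕ r ℕ.<? k) then + n else 0ℤ)
      displacement r with does (toℕ r ℕ.<? k)
      ... | true  = cancel (window r) (+ n)
      ... | false = ℤ.+-inverseʳ (window r)

    x∈S̃ : k ≤ n → x ∈ S̃⁽ k ⁾
    x∈S̃ k≤n = *≡* (begin
      ↥ (σ / n) * + 1      ≡⟨ ℤ.*-identityʳ _ ⟩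
      ↥ (σ / n)            ≡⟨ ℚᵘ.↥[n/d]≡n σ n ⟩
      σ                    ≡⟨ x-sum k≤n ⟩
      + k * + n            ≡⟨ cong (+ k *_) (ℚᵘ.↧[n/d]≡d σ n) ⟨
      + k * ↧ (σ / n)      ∎)
      where
      open ≡-Reasoning
      σ = sum {n} (λ r → to x (window r) - window r)

    x⁻¹-increasing⇒≈ε : k ≤ n → Increasing (x ⁻¹) → toAffineWeyl k x ≈ ε
    x⁻¹-increasing⇒≈ε k≤n inc i = begin
      to x (to ((Λ ⁻¹) ^ k) i)  ≡⟨ cong (to x) (Λ⁻¹^-to k i) ⟩
      to x (i - + k)            ≡⟨ translation (i - + k) ⟩
      i - + k - c               ≡⟨ cong (λ d → i - + k + d) -c≡k ⟩
      i - + k + + k             ≡⟨ cancel i (+ k) ⟩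
      i                         ∎
      where
      open ≡-Reasoning
      cancel : ∀ i k → i - k + k ≡ i
      cancel = solve-∀
      cancel′ : ∀ i k → i + k - i ≡ k
      cancel′ = solve-∀
      c = proj₁ (increasing⇒translation (x ⁻¹) inc)
      translation : ∀ i → to x i ≡ i - c
      translation i = from-unique (x ⁻¹) (trans (proj₂ (increasing⇒translation (x ⁻¹) inc) (i - c)) (cancel i c))
      -c≡k : - c ≡ + k
      -c≡k = ℤ.*-cancelʳ-≡ (- c) (+ k) (+ n) (begin
        - c * + n                                   ≡⟨ ℤ.*-comm (- c) (+ n) ⟩
        + n * - c                                   ≡⟨ sum-const n (- c) ⟨
        sum {n} (λ _ → - c)                         ≡⟨ sum-cong-≗ {n} (λ r → trans (cong (_- window r) (translation (window r))) (cancel′ (window r) (- c))) ⟨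
        sum {n} (λ r → to x (window r) - window r)  ≡⟨ x-sum k≤n ⟩
        + k * + n                                   ∎)

    x⁻¹-descent₀ : k ≤ n → Grassmannian k w → ¬ (toAffineWeyl k x ≈ ε) → from x 1ℤ < from x 0ℤ
    x⁻¹-descent₀ k≤n gr x≉ with ℤ.<-cmp (from x 0ℤ) (from x 1ℤ)
    ... | tri> _ _ gt = gt
    ... | tri≈ _ eq _ = contradiction (trans (sym (to-from x 0ℤ)) (trans (cong (to x) eq) (to-from x 1ℤ))) λ ()
    ... | tri< lt _ _ = contradiction (x⁻¹-increasing⇒≈ε k≤n (steps⇒increasing (x ⁻¹) step)) x≉
      where
      step : ∀ i → from x i < from x (i + 1ℤ)
      step i with quotient-step {n} i
      ... | inj₁ same       = x⁻¹-blockIncreasing gr i (i + 1ℤ) same (i<i+1 i)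
      ... | inj₂ (q , refl) = subst₂ (_<_ on from x) (ℤ.+-identityˡ (q * + n)) (ℤ.+-comm 1ℤ (q * + n)) (to-shifted-< (x ⁻¹) {0ℤ} {1ℤ} q lt)

lemma3p8 : (n k : ℕ) .{{_ : NonTrivial n}} → k ≤ n →
    (w : Permutation′ n) → Grassmannian k w →
    ¬ (toAffineWeyl k x[ k , w ] ≈ ε) →
    (RightDescentSet x[ k , w ] ≐ (_≈ s 0)) ×
    (x[ k , w ] ∈ S̃ᴶ⁽ k ⁾) ×
    IsUniqueShortest (LeftCoset x[ k , w ] W_J) x[ k , w ]
lemma3p8 n k k≤n w gr x≉ = conclusion
  where
  -- Left without a signature: checked against the goal directly, the element is still a
  -- metavariable when the types are compared, and unification unfolds ℓ.
  conclusion = blockIncreasing∧descent₀⇒minimal {n} x[ k , w ] (x⁻¹-blockIncreasing k w gr)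
    (x⁻¹-descent₀ k w k≤n gr x≉) k (x∈S̃ k w k≤n)
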